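{- Let $H$ be a Hadamard matrix of order $v^2$. Then there exists a $\mathcal{C}^3_3\big(v^6,\ v^8(v^4-1)/2,\ v^8(v^4-2)/4\big)$-cube containing a $\mathcal{C}^3_3\big(v^3,\ v^4(v^2-1)/2,\ v^4(v^2-2)/4\big)$-cube as a subcube.
   Context: A $w\times w\times w$ array is a function on $\{1,\dots,w\}^3$. A layer is obtained by fixing one of the three coordinates; two layers are parallel if they fix the same coordinate, to different values; their scalar product is the sum over all positions of the product of corresponding entries. $\mathcal{C}^3_3(w,k,\lambda)$ is the set of $w\times w\times w$ arrays over $\{0,1\}$ such that every layer (in each of the three directions) contains exactly $k$ ones and every two parallel layers have scalar product $\lambda$; its elements are called $\mathcal{C}^3_3(w,k,\lambda)$-cubes. A subcube of an array is the array obtained by restricting each of the three coordinates to a subset of the index set, the three subsets having the same size. A Hadamard matrix of order $n$ is an $n\times n$ matrix over $\{1,-1\}$ whose distinct rows are orthogonal and whose distinct columns are orthogonal. -}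

module Defs where

open import Data.Bool.Base using (if_then_else_)
open import Data.Fin.Base using (Fin; toℕ) renaming (_<_ to _<ᶠ_)
open import Data.Fin.Patterns using (0F; 1F; 2F)
open import Data.Fin.Properties using (_≟_)
open import Data.Integer.Base as ℤ using (ℤ; +_; 0ℤ; 1ℤ; -1ℤ)
import Data.Integer.Properties as ℤ
open import Data.Nat.Base as ℕ using (ℕ)
import Data.Nat.Properties as ℕ
open import Data.Product.Base using (Σ; _×_; ∃-syntax)
open import Data.Rational.Base using (ℚ; _/_)
open import Data.Sum.Base using (_⊎_)
open import Relation.Binary.Core using (_Preserves_⟶_)
open import Relation.Binary.PropositionalEquality.Core using (_≡_; _≢_)
open import Relation.Nullary.Decidable.Core using (does)

open import Algebra.Properties.Semiring.Sum ℕ.+-*-semiring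
  using () renaming (sum to sumℕ)
open import Algebra.Properties.Semiring.Sum ℤ.+-*-semiring
  using () renaming (sum to sumℤ)

Matrix : Set → ℕ → Set
Matrix A n = Fin n → Fin n → A

Array : Set → ℕ → Set
Array A w = Fin w → Fin w → Fin w → A

record IsHadamard {n : ℕ} (H : Matrix ℤ n) : Set where
  field
    entries      : ∀ i j → H i j ≡ 1ℤ ⊎ H i j ≡ -1ℤ
    rows-orth    : ∀ i i′ → i ≢ i′ → sumℤ (λ j → H i j ℤ.* H i′ j) ≡ 0ℤ
    columns-orth : ∀ j j′ → j ≢ j′ → sumℤ (λ i → H i j ℤ.* H i j′) ≡ 0ℤ

layer : {A : Set} {w : ℕ} → Array A w → Fin 3 → Fin w → Matrix A w
layer C 0F a = λ y z → C a y z
layer C 1F a = λ x z → C x a z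
layer C 2F a = λ x y → C x y a

ones : {w : ℕ} → Matrix (Fin 2) w → ℕ
ones L = sumℕ λ i → sumℕ λ j → if does (L i j ≟ 1F) then 1 else 0

-- The alphabet {0,1} is Fin 2; toℕ reads a symbol as a number.
scalarProduct : {w : ℕ} → Matrix (Fin 2) w → Matrix (Fin 2) w → ℕ
scalarProduct L M = sumℕ λ i → sumℕ λ j → toℕ (L i j) ℕ.* toℕ (M i j)

-- The parameters k and l are rational so that they can be given by
-- fractions with exact division. For w = 1 there are no two parallel
-- layers, and l is unconstrained (possibly negative or non-integral).
record IsCube {w : ℕ} (k l : ℚ) (C : Array (Fin 2) w) : Set where
  field
    layer-ones    : ∀ d a → + ones (layer C d a) / 1 ≡ k
    layer-product : ∀ d a b → a ≢ b →
                    + scalarProduct (layer C d a) (layer C d b) / 1 ≡ l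

𝒞³₃ : (w : ℕ) (k l : ℚ) → Set
𝒞³₃ w k l = Σ (Array (Fin 2) w) (IsCube k l)

StrictlyIncreasing : {m w : ℕ} → (Fin m → Fin w) → Set
StrictlyIncreasing f = f Preserves _<ᶠ_ ⟶ _<ᶠ_

-- An m-element subset of the index set Fin w is given by its increasing
-- enumeration Fin m → Fin w, which also indexes the restricted array.
_IsSubcubeOf_ : {A : Set} {m w : ℕ} → Array A m → Array A w → Set
_IsSubcubeOf_ {m = m} {w} B C =
  ∃[ f ] ∃[ g ] ∃[ h ]
    StrictlyIncreasing {m} {w} f ×
    StrictlyIncreasing {m} {w} g ×
    StrictlyIncreasing {m} {w} h ×
    (∀ x y z → B x y z ≡ C (f x) (g y) (h z))

-- Call a {1,−1}-array regular if all layers have the same sum; via X = 1 − 2C,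
-- the cubes in question are the regular arrays with orthogonal parallel layers.
-- Index by pairs x = (x₁ , x₂) with x₁ ∈ [v], x₂ ∈ [v²], and let
-- G c (a , b) p = H (a , b) p · H (c , c) p, a Hadamard matrix with row (c , c) all ones.
-- The array of order v³
--   X x y z = G z₁ (x₁ , y₁) z₂ · G x₁ (y₁ , z₁) x₂ · G y₁ (z₁ , x₁) y₂
-- is invariant under cyclic shifts. Layers with x₁ ≠ x₁′ are orthogonal by summing
-- the first factor over z₂, layers with x₁ = x₁′ and x₂ ≠ x₂′ by summing the second
-- one over (y₁ , z₁). Summing over y₂ and z₂ kills everything except
-- y₁ = z₁ = x₁, so layers have sum v²·v². The Kronecker square of X has
-- order v⁶ and contains X, because X x x x = 1.

module Submission where

open import Data.Empty using (⊥-elim)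
open import Data.Fin.Base using (Fin; zero; suc; toℕ; combine; remQuot; _↑ˡ_; _↑ʳ_)
open import Data.Fin.Patterns using (0F; 1F; 2F)
open import Data.Fin.Properties using (_≟_; combine-injectiveˡ; combine-injectiveʳ;
  combine-monoˡ-<; combine-remQuot; remQuot-combine)
open import Data.Integer.Base using (ℤ; +_; -[1+_]; _+_; _*_; _-_; 0ℤ; 1ℤ; -1ℤ)
open import Data.Integer.Properties using (+-*-semiring; +-identityʳ; +-identityˡ; +-assoc;
  +-0-abelianGroup; *-comm; *-identityˡ; *-identityʳ; *-zeroˡ; *-zeroʳ; pos-*)
open import Data.Integer.Tactic.RingSolver using (solve-∀)
import Data.Nat.Base as ℕ
open import Data.Nat.Base using (ℕ; NonZero; _^_)
open import Data.Nat.Properties using (^-distribˡ-+-*) renaming (+-*-semiring to ℕ-semiring)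
open import Data.Product.Base using (Σ; _×_; _,_; proj₁; proj₂; uncurry; ∃-syntax)
open import Data.Rational.Base using (_/_)
open import Data.Rational.Properties using (fromℚᵘ-cong)
open import Data.Rational.Unnormalised.Base using (mkℚᵘ; *≡*)
open import Data.Sum.Base using (_⊎_; inj₁; inj₂)
open import Function.Base using (_∘_)
open import Relation.Binary.PropositionalEquality
open import Relation.Nullary.Negation.Core using (¬_)
open import Relation.Nullary.Decidable.Core using (does; yes; no)
open import Defs

open import Algebra.Bundles using (AbelianGroup)
open import Algebra.Properties.Group (AbelianGroup.group +-0-abelianGroup)
  using () renaming (∙-cancelˡ to +-cancelˡ)
open import Algebra.Properties.Semiring.Sum +-*-semiring
open import Algebra.Properties.Semiring.Sum ℕ-semiring using () renaming (sum to sumℕ)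

open ≡-Reasoning

-- Finite single and double sums of integers.

∑-zero : ∀ {n} {f : Fin n → ℤ} → (∀ i → f i ≡ 0ℤ) → sum f ≡ 0ℤ
∑-zero {n} f≡0 = trans (sum-cong-≗ f≡0) (sum-replicate-zero n)

∑-one : ∀ n → ∑[ i < n ] 1ℤ ≡ + n
∑-one ℕ.zero    = refl
∑-one (ℕ.suc n) = cong (_+_ 1ℤ) (∑-one n)

∑-support : ∀ {n} (f : Fin n → ℤ) (i : Fin n) → (∀ j → j ≢ i → f j ≡ 0ℤ) → sum f ≡ f i
∑-support f zero h =
  trans (cong (_+_ (f zero)) (∑-zero λ j → h (suc j) λ ())) (+-identityʳ _)
∑-support f (suc i) h = begin
  f zero + sum (f ∘ suc) ≡⟨ cong₂ _+_ (h zero λ ())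
                              (∑-support (f ∘ suc) i λ j j≢i → h (suc j) λ { refl → j≢i refl }) ⟩
  0ℤ + f (suc i)         ≡⟨ +-identityˡ _ ⟩
  f (suc i)              ∎

∑-++ : ∀ m n (f : Fin (m ℕ.+ n) → ℤ) → sum f ≡ ∑[ i < m ] f (i ↑ˡ n) + ∑[ j < n ] f (m ↑ʳ j)
∑-++ ℕ.zero    n f = sym (+-identityˡ _)
∑-++ (ℕ.suc m) n f = trans (cong (_+_ (f zero)) (∑-++ m n (f ∘ suc))) (sym (+-assoc (f zero) _ _))

∑-combine : ∀ m n (f : Fin (m ℕ.* n) → ℤ) → sum f ≡ ∑[ i < m ] ∑[ j < n ] f (combine i j)
∑-combine ℕ.zero    n f = refl
∑-combine (ℕ.suc m) n f =
  trans (∑-++ n (m ℕ.* n) f) (cong (_+_ (∑[ j < n ] f (j ↑ˡ (m ℕ.* n)))) (∑-combine m n (f ∘ (n ↑ʳ_))))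

∑-remQuot : ∀ m n (f : Fin m × Fin n → ℤ) →
            ∑[ x < m ℕ.* n ] f (remQuot {m} n x) ≡ ∑[ i < m ] ∑[ j < n ] f (i , j)
∑-remQuot m n f = trans (∑-combine m n _)
  (sum-cong-≗ λ i → sum-cong-≗ λ j → cong f (remQuot-combine i j))

∑∑ : ∀ {m n} → (Fin m → Fin n → ℤ) → ℤ
∑∑ {m} {n} F = ∑[ i < m ] ∑[ j < n ] F i j

∑∑-cong : ∀ {m n} {F G : Fin m → Fin n → ℤ} → (∀ i j → F i j ≡ G i j) → ∑∑ F ≡ ∑∑ G
∑∑-cong F≡G = sum-cong-≗ λ i → sum-cong-≗ λ j → F≡G i j

∑∑-distrib-+ : ∀ {m n} (F G : Fin m → Fin n → ℤ) → ∑∑ (λ i j → F i j + G i j) ≡ ∑∑ F + ∑∑ G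
∑∑-distrib-+ F G =
  trans (sum-cong-≗ λ i → ∑-distrib-+ (F i) (G i)) (∑-distrib-+ (sum ∘ F) (sum ∘ G))

*-distribˡ-∑∑ : ∀ {m n} c (F : Fin m → Fin n → ℤ) → c * ∑∑ F ≡ ∑∑ (λ i j → c * F i j)
*-distribˡ-∑∑ c F =
  trans (*-distribˡ-sum c (sum ∘ F)) (sum-cong-≗ λ i → *-distribˡ-sum c (F i))

*-distribʳ-∑∑ : ∀ {m n} c (F : Fin m → Fin n → ℤ) → ∑∑ F * c ≡ ∑∑ (λ i j → F i j * c)
*-distribʳ-∑∑ c F =
  trans (*-distribʳ-sum c (sum ∘ F)) (sum-cong-≗ λ i → *-distribʳ-sum c (F i))

∑∑-one : ∀ m n → ∑∑ {m} {n} (λ _ _ → 1ℤ) ≡ + m * + n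
∑∑-one m n = begin
  ∑[ i < m ] ∑[ j < n ] 1ℤ ≡⟨ sum-cong-≗ (λ (i : Fin m) → trans (∑-one n) (sym (*-identityˡ _))) ⟩
  ∑[ i < m ] (1ℤ * + n)    ≡⟨ *-distribʳ-sum (+ n) (λ (i : Fin m) → 1ℤ) ⟨
  (∑[ i < m ] 1ℤ) * + n    ≡⟨ cong (_* + n) (∑-one m) ⟩
  + m * + n                ∎

∑∑-product : ∀ {m n} (f : Fin m → ℤ) (g : Fin n → ℤ) → ∑∑ (λ i j → f i * g j) ≡ sum f * sum g
∑∑-product f g =
  trans (sum-cong-≗ λ i → sym (*-distribˡ-sum (f i) g)) (sym (*-distribʳ-sum (sum g) f))

-- One exchange of summations brings both first components outside, so that the sum over the second
-- components can be evaluated with the first ones fixed.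
∑∑-remQuot : ∀ m n (F : Fin m × Fin n → Fin m × Fin n → ℤ) →
             ∑∑ (λ y z → F (remQuot n y) (remQuot n z)) ≡
             ∑∑ (λ b c → ∑∑ λ q r → F (b , q) (c , r))
∑∑-remQuot m n F = begin
  ∑∑ (λ y z → F (remQuot n y) (remQuot n z))
    ≡⟨ sum-cong-≗ (λ y → ∑-remQuot m n (F (remQuot n y))) ⟩
  ∑[ y < m ℕ.* n ] ∑[ c < m ] ∑[ r < n ] F (remQuot n y) (c , r)
    ≡⟨ ∑-remQuot m n (λ y → ∑[ c < m ] ∑[ r < n ] F y (c , r)) ⟩
  ∑[ b < m ] ∑[ q < n ] ∑[ c < m ] ∑[ r < n ] F (b , q) (c , r)
    ≡⟨ sum-cong-≗ (λ b → ∑-comm λ q c → ∑[ r < n ] F (b , q) (c , r)) ⟩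
  ∑∑ (λ b c → ∑∑ λ q r → F (b , q) (c , r)) ∎

pos-∑∑ : ∀ {m n} (F : Fin m → Fin n → ℕ) →
         + (sumℕ λ i → sumℕ λ j → F i j) ≡ ∑∑ (λ i j → + F i j)
pos-∑∑ F = trans (pos-∑ (sumℕ ∘ F)) (sum-cong-≗ λ i → pos-∑ (F i))
  where
  pos-∑ : ∀ {n} (f : Fin n → ℕ) → + sumℕ f ≡ ∑[ i < n ] (+ f i)
  pos-∑ {ℕ.zero}  f = refl
  pos-∑ {ℕ.suc n} f = cong (_+_ (+ f zero)) (pos-∑ (f ∘ suc))

-- Arrays of signs with cyclic symmetry.

IsSign : ℤ → Set
IsSign z = z ≡ 1ℤ ⊎ z ≡ -1ℤ

sign-* : ∀ {x y} → IsSign x → IsSign y → IsSign (x * y)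
sign-* (inj₁ refl) (inj₁ refl) = inj₁ refl
sign-* (inj₁ refl) (inj₂ refl) = inj₂ refl
sign-* (inj₂ refl) (inj₁ refl) = inj₂ refl
sign-* (inj₂ refl) (inj₂ refl) = inj₁ refl

sign-square : ∀ {x} → IsSign x → x * x ≡ 1ℤ
sign-square (inj₁ refl) = refl
sign-square (inj₂ refl) = refl

bit : ℤ → Fin 2
bit (+ _)    = 0F
bit -[1+ _ ] = 1F

-- By cyclic invariance the conditions on layers are needed in one direction only.
record IsSignCube {w : ℕ} (s : ℤ) (X : Array ℤ w) : Set where
  field
    entries   : ∀ x y z → IsSign (X x y z)
    cyclic    : ∀ x y z → X x y z ≡ X y z x
    layer-sum : ∀ x → ∑∑ (X x) ≡ s
    orth      : ∀ x x′ → x ≢ x′ → ∑∑ (λ y z → X x y z * X x′ y z) ≡ 0ℤ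

module _ {w : ℕ} {s : ℤ} {X : Array ℤ w} (isSignCube : IsSignCube s X) where
  open IsSignCube isSignCube

  layer-entries : ∀ d a i j → IsSign (layer X d a i j)
  layer-entries 0F a i j = entries a i j
  layer-entries 1F a i j = entries i a j
  layer-entries 2F a i j = entries i j a

  ∑∑-layer : ∀ d a → ∑∑ (layer X d a) ≡ s
  ∑∑-layer 0F a = layer-sum a
  -- One shift turns this layer into the transpose of a layer in the first direction, hence the
  -- exchange of sums. In the third direction the opposite shift keeps the order of the two free
  -- coordinates.
  ∑∑-layer 1F a = begin
    ∑∑ (λ x z → X x a z) ≡⟨ ∑∑-cong (λ x z → cyclic x a z) ⟩
    ∑∑ (λ x z → X a z x) ≡⟨ ∑-comm (λ x z → X a z x) ⟩
    ∑∑ (X a)             ≡⟨ layer-sum a ⟩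
    s                    ∎
  ∑∑-layer 2F a = trans (∑∑-cong λ x y → sym (cyclic a x y)) (layer-sum a)

  layer-orth : ∀ d a b → a ≢ b → ∑∑ (λ i j → layer X d a i j * layer X d b i j) ≡ 0ℤ
  layer-orth 0F a b a≢b = orth a b a≢b
  layer-orth 1F a b a≢b = begin
    ∑∑ (λ x z → X x a z * X x b z) ≡⟨ ∑∑-cong (λ x z → cong₂ _*_ (cyclic x a z) (cyclic x b z)) ⟩
    ∑∑ (λ x z → X a z x * X b z x) ≡⟨ ∑-comm (λ x z → X a z x * X b z x) ⟩
    ∑∑ (λ z x → X a z x * X b z x) ≡⟨ orth a b a≢b ⟩
    0ℤ                             ∎
  layer-orth 2F a b a≢b =
    trans (∑∑-cong λ x y → sym (cong₂ _*_ (cyclic a x y) (cyclic b x y))) (orth a b a≢b)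

-- From sign arrays to cubes over {0,1}.

bits : ∀ {w} → Array ℤ w → Array (Fin 2) w
bits X x y z = bit (X x y z)

layer-bits : ∀ {w} (X : Array ℤ w) d a i j → layer (bits X) d a i j ≡ bit (layer X d a i j)
layer-bits X 0F a i j = refl
layer-bits X 1F a i j = refl
layer-bits X 2F a i j = refl

-- A sign x and its bit b satisfy x + 2b = 1; this is summed over the w² positions.
ones-sign : ∀ {w} (L : Matrix (Fin 2) w) (M : Matrix ℤ w) →
            (∀ i j → IsSign (M i j)) → (∀ i j → L i j ≡ bit (M i j)) →
            ∑∑ M + + 2 * + ones L ≡ + w * + w
ones-sign {w} L M M± L≡ = begin
  ∑∑ M + + 2 * + ones L                            ≡⟨ cong (λ t → ∑∑ M + + 2 * t) (pos-∑∑ λ i j → [ L i j ]₁) ⟩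
  ∑∑ M + + 2 * ∑∑ (λ i j → + [ L i j ]₁)           ≡⟨ cong (_+_ (∑∑ M)) (*-distribˡ-∑∑ (+ 2) λ i j → + [ L i j ]₁) ⟩
  ∑∑ M + ∑∑ (λ i j → + 2 * + [ L i j ]₁)           ≡⟨ ∑∑-distrib-+ M (λ i j → + 2 * + [ L i j ]₁) ⟨
  ∑∑ (λ i j → M i j + + 2 * + [ L i j ]₁)          ≡⟨ ∑∑-cong (λ i j → entry (M± i j) (L≡ i j)) ⟩
  ∑∑ {w} {w} (λ i j → 1ℤ)                          ≡⟨ ∑∑-one w w ⟩
  + w * + w                                        ∎
  where
  open import Data.Bool.Base using (if_then_else_)
  [_]₁ : Fin 2 → ℕ
  [ b ]₁ = if does (b ≟ 1F) then 1 else 0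
  entry : ∀ {x b} → IsSign x → b ≡ bit x → x + + 2 * + [ b ]₁ ≡ 1ℤ
  entry (inj₁ refl) refl = refl
  entry (inj₂ refl) refl = refl

-- This sums 4ab = (1 − x)(1 − y) = 1 + xy − (x + y) for x = 1 − 2a, y = 1 − 2b.
scalarProduct-sign : ∀ {w} (L L′ : Matrix (Fin 2) w) (M M′ : Matrix ℤ w) →
  (∀ i j → IsSign (M i j)) → (∀ i j → L i j ≡ bit (M i j)) →
  (∀ i j → IsSign (M′ i j)) → (∀ i j → L′ i j ≡ bit (M′ i j)) →
  (∑∑ M + ∑∑ M′) + + 4 * + scalarProduct L L′ ≡ + w * + w + ∑∑ (λ i j → M i j * M′ i j)
scalarProduct-sign {w} L L′ M M′ M± L≡ M′± L′≡ = begin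
  (∑∑ M + ∑∑ M′) + + 4 * + scalarProduct L L′
    ≡⟨ cong₂ _+_ (sym (∑∑-distrib-+ M M′))
         (trans (cong (+ 4 *_) (pos-∑∑ LL′)) (*-distribˡ-∑∑ (+ 4) λ i j → + LL′ i j)) ⟩
  ∑∑ (λ i j → M i j + M′ i j) + ∑∑ (λ i j → + 4 * + LL′ i j)
    ≡⟨ ∑∑-distrib-+ (λ i j → M i j + M′ i j) (λ i j → + 4 * + LL′ i j) ⟨
  ∑∑ (λ i j → (M i j + M′ i j) + + 4 * + LL′ i j)
    ≡⟨ ∑∑-cong (λ i j → entry (M± i j) (L≡ i j) (M′± i j) (L′≡ i j)) ⟩
  ∑∑ (λ i j → 1ℤ + M i j * M′ i j)
    ≡⟨ ∑∑-distrib-+ (λ i j → 1ℤ) (λ i j → M i j * M′ i j) ⟩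
  ∑∑ {w} {w} (λ i j → 1ℤ) + ∑∑ (λ i j → M i j * M′ i j)
    ≡⟨ cong (_+ ∑∑ (λ i j → M i j * M′ i j)) (∑∑-one w w) ⟩
  + w * + w + ∑∑ (λ i j → M i j * M′ i j) ∎
  where
  LL′ : Fin w → Fin w → ℕ
  LL′ i j = toℕ (L i j) ℕ.* toℕ (L′ i j)
  entry : ∀ {x y b c} → IsSign x → b ≡ bit x → IsSign y → c ≡ bit y →
          (x + y) + + 4 * + (toℕ b ℕ.* toℕ c) ≡ 1ℤ + x * y
  entry (inj₁ refl) refl (inj₁ refl) refl = refl
  entry (inj₁ refl) refl (inj₂ refl) refl = refl
  entry (inj₂ refl) refl (inj₁ refl) refl = refl
  entry (inj₂ refl) refl (inj₂ refl) refl = refl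

-- Equality of rationals reduces to cross-multiplication of unnormalised fractions. The divisor is
-- `ℕ.suc d`, so halves and quarters arise from d = 1 and d = 3.
/-exact : ∀ m d p → + ℕ.suc d * m ≡ p → m / 1 ≡ p / ℕ.suc d
/-exact m d p eq = fromℚᵘ-cong {mkℚᵘ m 0} {mkℚᵘ p d}
  (*≡* (trans (*-comm m (+ ℕ.suc d)) (trans eq (sym (*-identityʳ p)))))

-- The parameters K = w² - s and L = w² - 2s are specified additively, so that the two counting
-- identities yield them by cancelling `s` and `s + s`.
bits-isCube : ∀ {w} s K L {X : Array ℤ w} → IsSignCube s X →
              s + K ≡ + w * + w → (s + s) + L ≡ + w * + w → IsCube (K / 2) (L / 4) (bits X)
bits-isCube {w} s K L {X} isSignCube s+K s+s+L = record
  { layer-ones    = λ d a →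
      let M = layer X d a ; B = layer (bits X) d a in
      /-exact (+ ones B) 1 K (+-cancelˡ s (+ 2 * + ones B) K (begin
        s + + 2 * + ones B
          ≡⟨ cong (_+ + 2 * + ones B) (∑∑-layer isSignCube d a) ⟨
        ∑∑ M + + 2 * + ones B
          ≡⟨ ones-sign B M (layer-entries isSignCube d a) (layer-bits X d a) ⟩
        + w * + w
          ≡⟨ s+K ⟨
        s + K ∎))
  ; layer-product = λ d a b a≢b →
      let M = layer X d a ; B = layer (bits X) d a
          M′ = layer X d b ; B′ = layer (bits X) d b
          π = + scalarProduct B B′
      in
      /-exact π 3 L (+-cancelˡ (s + s) (+ 4 * π) L (begin
        (s + s) + + 4 * π
          ≡⟨ cong (_+ + 4 * π) (cong₂ _+_ (∑∑-layer isSignCube d a) (∑∑-layer isSignCube d b)) ⟨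
        (∑∑ M + ∑∑ M′) + + 4 * π
          ≡⟨ scalarProduct-sign B B′ M M′ (layer-entries isSignCube d a) (layer-bits X d a)
               (layer-entries isSignCube d b) (layer-bits X d b) ⟩
        + w * + w + ∑∑ (λ i j → M i j * M′ i j)
          ≡⟨ cong (_+_ (+ w * + w)) (layer-orth isSignCube d a b a≢b) ⟩
        + w * + w + 0ℤ
          ≡⟨ +-identityʳ (+ w * + w) ⟩
        + w * + w
          ≡⟨ s+s+L ⟨
        (s + s) + L ∎))
  }

-- Kronecker products of sign cubes.

remQuot-injective : ∀ {m} n {x y : Fin (m ℕ.* n)} → remQuot {m} n x ≡ remQuot n y → x ≡ y
remQuot-injective {m} n {x} {y} eq =
  trans (sym (combine-remQuot {m} n x)) (trans (cong (uncurry combine) eq) (combine-remQuot {m} n y))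

*-interchange : ∀ a b c d → (a * b) * (c * d) ≡ (a * c) * (b * d)
*-interchange = solve-∀

module Kronecker {m n} (X : Array ℤ m) (Y : Array ℤ n) where

  -- Kept on pairs, before flattening to `Fin (m ℕ.* n)`, so that `∑∑-remQuot` applies directly.
  _⊗_ : (Fin m → Fin m → ℤ) → (Fin n → Fin n → ℤ) → Fin m × Fin n → Fin m × Fin n → ℤ
  (F ⊗ G) (y₁ , y₂) (z₁ , z₂) = F y₁ z₁ * G y₂ z₂

  kronecker : Array ℤ (m ℕ.* n)
  kronecker x y z = (X (proj₁ (remQuot n x)) ⊗ Y (proj₂ (remQuot {m} n x))) (remQuot n y) (remQuot n z)

  kronecker-combine : ∀ x₁ x₂ y₁ y₂ z₁ z₂ →
    kronecker (combine x₁ x₂) (combine y₁ y₂) (combine z₁ z₂) ≡ X x₁ y₁ z₁ * Y x₂ y₂ z₂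
  kronecker-combine x₁ x₂ y₁ y₂ z₁ z₂ = trans
    (cong (λ x → (X (proj₁ x) ⊗ Y (proj₂ x)) _ _) (remQuot-combine x₁ x₂))
    (cong₂ (X x₁ ⊗ Y x₂) (remQuot-combine y₁ y₂) (remQuot-combine z₁ z₂))

  ∑∑-⊗ : ∀ F G → ∑∑ (λ y z → (F ⊗ G) (remQuot n y) (remQuot n z)) ≡ ∑∑ F * ∑∑ G
  ∑∑-⊗ F G = begin
    ∑∑ (λ y z → (F ⊗ G) (remQuot n y) (remQuot n z)) ≡⟨ ∑∑-remQuot m n (F ⊗ G) ⟩
    ∑∑ (λ b c → ∑∑ λ q r → F b c * G q r)            ≡⟨ ∑∑-cong (λ b c → *-distribˡ-∑∑ (F b c) G) ⟨
    ∑∑ (λ b c → F b c * ∑∑ G)                        ≡⟨ *-distribʳ-∑∑ (∑∑ G) F ⟨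
    ∑∑ F * ∑∑ G                                      ∎

  -- By `∑∑-⊗`, layer sums and scalar products of layers both factor. Distinct indices differ in at
  -- least one component, and the scalar product belonging to that component is zero.
  kronecker-isSignCube : ∀ {s t} → IsSignCube s X → IsSignCube t Y →
                         IsSignCube (s * t) kronecker
  kronecker-isSignCube isX isY = record
    { entries   = λ x y z → sign-* (𝕏.entries _ _ _) (𝕐.entries _ _ _)
    ; cyclic    = λ x y z → cong₂ _*_ (𝕏.cyclic _ _ _) (𝕐.cyclic _ _ _)
    ; layer-sum = λ x → trans (∑∑-⊗ (X _) (Y _)) (cong₂ _*_ (𝕏.layer-sum _) (𝕐.layer-sum _))
    ; orth      = λ x x′ x≢x′ → begin
        ∑∑ (λ y z → kronecker x y z * kronecker x′ y z)
          ≡⟨ ∑∑-cong (λ y z → *-interchange (X (x₁ x) (x₁ y) (x₁ z)) (Y (x₂ x) (x₂ y) (x₂ z))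
                                           (X (x₁ x′) (x₁ y) (x₁ z)) (Y (x₂ x′) (x₂ y) (x₂ z))) ⟩
        ∑∑ (λ y z → (XX x x′ ⊗ YY x x′) (remQuot n y) (remQuot n z))
          ≡⟨ ∑∑-⊗ (XX x x′) (YY x x′) ⟩
        ∑∑ (XX x x′) * ∑∑ (YY x x′)
          ≡⟨ vanish x x′ x≢x′ ⟩
        0ℤ ∎
    }
    where
    module 𝕏 = IsSignCube isX
    module 𝕐 = IsSignCube isY

    x₁ : Fin (m ℕ.* n) → Fin m
    x₁ = proj₁ ∘ remQuot n
    x₂ : Fin (m ℕ.* n) → Fin n
    x₂ = proj₂ ∘ remQuot {m} n

    XX : Fin (m ℕ.* n) → Fin (m ℕ.* n) → Matrix ℤ m
    XX x x′ y z = X (x₁ x) y z * X (x₁ x′) y z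

    YY : Fin (m ℕ.* n) → Fin (m ℕ.* n) → Matrix ℤ n
    YY x x′ y z = Y (x₂ x) y z * Y (x₂ x′) y z

    vanish : ∀ x x′ → x ≢ x′ → ∑∑ (XX x x′) * ∑∑ (YY x x′) ≡ 0ℤ
    vanish x x′ x≢x′ with x₁ x ≟ x₁ x′ | x₂ x ≟ x₂ x′
    ... | no a≢a′  | _       =
      trans (cong (_* ∑∑ (YY x x′)) (𝕏.orth _ _ a≢a′)) (*-zeroˡ (∑∑ (YY x x′)))
    ... | yes _    | no p≢p′  =
      trans (cong (∑∑ (XX x x′) *_) (𝕐.orth _ _ p≢p′)) (*-zeroʳ (∑∑ (XX x x′)))
    ... | yes a≡a′ | yes p≡p′ = ⊥-elim (x≢x′ (remQuot-injective {m} n (cong₂ _,_ a≡a′ p≡p′)))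

-- The order is only propositionally a square, to allow v ^ 6 ≡ v ^ 3 * v ^ 3.
kronecker-square : ∀ {w W s} → W ≡ w ℕ.* w → (X : Array ℤ w) → IsSignCube s X →
  (o : Fin w) → X o o o ≡ 1ℤ →
  Σ (Array ℤ W) λ Y → IsSignCube (s * s) Y ×
  ∃[ f ] StrictlyIncreasing {w} {W} f × (∀ x y z → X x y z ≡ Y (f x) (f y) (f z))
kronecker-square refl X isX o Xo≡1 =
  kronecker , kronecker-isSignCube isX isX ,
  -- Fixing the second component at `o` in all three directions leaves `X` multiplied by the
  -- constant `X o o o`. The first component is the leading digit, so the embedding is increasing.
  (λ x → combine x o) , combine-monoˡ-< o o ,
  λ x y z → sym (begin
    kronecker (combine x o) (combine y o) (combine z o) ≡⟨ kronecker-combine x o y o z o ⟩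
    X x y z * X o o o                                   ≡⟨ cong (X x y z *_) Xo≡1 ⟩
    X x y z * 1ℤ                                        ≡⟨ *-identityʳ _ ⟩
    X x y z                                             ∎)
  where open Kronecker X X

-- Rows of a matrix of order v² indexed by pairs.

pair : ∀ {v} → Fin v → Fin v → Fin (v ^ 2)
-- `v ^ 2` unfolds to `v ℕ.* (v ℕ.* 1)`, so a last digit in `Fin 1` is required.
pair a b = combine a (combine b 0F)

pair-injective : ∀ {v} (a b c d : Fin v) → pair a b ≡ pair c d → a ≡ c × b ≡ d
pair-injective {v} a b c d eq =
  combine-injectiveˡ a (combine b o) c (combine d o) eq ,
  combine-injectiveˡ b o d o (combine-injectiveʳ a (combine b o) c (combine d o) eq)
  where
  o : Fin 1
  o = 0F

∑-pair : ∀ v (f : Fin (v ^ 2) → ℤ) → sum f ≡ ∑∑ (λ (a b : Fin v) → f (pair a b))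
∑-pair v f = begin
  sum f
    ≡⟨ ∑-combine v (v ℕ.* 1) f ⟩
  ∑∑ {v} {v ℕ.* 1} (λ a j → f (combine a j))
    ≡⟨ sum-cong-≗ (λ (a : Fin v) → ∑-combine v 1 (f ∘ combine {v} a)) ⟩
  ∑∑ (λ (a b : Fin v) → f (pair a b) + 0ℤ)
    ≡⟨ ∑∑-cong (λ (a b : Fin v) → +-identityʳ (f (pair a b))) ⟩
  ∑∑ (λ (a b : Fin v) → f (pair a b)) ∎

-- The sign cube of order v³ built from a Hadamard matrix.

module HadamardCube {v : ℕ} (H : Matrix ℤ (v ^ 2)) (isHadamard : IsHadamard H) where
  open IsHadamard isHadamard renaming (entries to H-entries)

  n : ℕ
  n = v ^ 2

  H₂ : Fin v → Fin v → Fin n → ℤ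
  H₂ a b = H (pair a b)

  G : Fin v → Fin v → Fin v → Fin n → ℤ
  G c a b p = H₂ a b p * H₂ c c p

  G-sign : ∀ c a b p → IsSign (G c a b p)
  G-sign c a b p = sign-* (H-entries (pair a b) p) (H-entries (pair c c) p)

  G-one : ∀ c p → G c c c p ≡ 1ℤ
  G-one c p = sign-square (H-entries (pair c c) p)

  ∑-G-one : ∀ c → ∑[ p < n ] G c c c p ≡ + n
  ∑-G-one c = trans (sum-cong-≗ (G-one c)) (∑-one n)

  -- The sum is the scalar product of the rows (a , b) and (c , c) of `H`, which are distinct.
  ∑-G-zero : ∀ c a b → ¬ (a ≡ c × b ≡ c) → ∑[ p < n ] G c a b p ≡ 0ℤ
  ∑-G-zero c a b h = rows-orth _ _ (h ∘ pair-injective a b c c)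

  -- The normalising row enters squared, hence as 1, which leaves the rows (a , b) and (a′ , b) of
  -- `H`.
  G-rows-orth : ∀ c a a′ b → a ≢ a′ → ∑[ p < n ] (G c a b p * G c a′ b p) ≡ 0ℤ
  G-rows-orth c a a′ b a≢a′ = begin
    ∑[ p < n ] (G c a b p * G c a′ b p)
      ≡⟨ sum-cong-≗ (λ p → *-interchange (H₂ a b p) (H₂ c c p) (H₂ a′ b p) (H₂ c c p)) ⟩
    ∑[ p < n ] (H₂ a b p * H₂ a′ b p * (H₂ c c p * H₂ c c p))
      ≡⟨ sum-cong-≗ (λ p → cong (H₂ a b p * H₂ a′ b p *_) (G-one c p)) ⟩
    ∑[ p < n ] (H₂ a b p * H₂ a′ b p * 1ℤ)
      ≡⟨ sum-cong-≗ (λ p → *-identityʳ (H₂ a b p * H₂ a′ b p)) ⟩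
    ∑[ p < n ] (H₂ a b p * H₂ a′ b p)
      ≡⟨ rows-orth _ _ (a≢a′ ∘ proj₁ ∘ pair-injective a b a′ b) ⟩
    0ℤ ∎

  -- Normalisation multiplies each column of `H` by a constant sign, so the scalar product of two
  -- columns only acquires the factor `ε`.
  G-columns-orth : ∀ c p p′ → p ≢ p′ → ∑∑ (λ a b → G c a b p * G c a b p′) ≡ 0ℤ
  G-columns-orth c p p′ p≢p′ = begin
    ∑∑ (λ a b → G c a b p * G c a b p′)
      ≡⟨ ∑∑-cong (λ a b → *-interchange (H₂ a b p) (H₂ c c p) (H₂ a b p′) (H₂ c c p′)) ⟩
    ∑∑ (λ a b → H₂ a b p * H₂ a b p′ * ε)
      ≡⟨ *-distribʳ-∑∑ ε (λ a b → H₂ a b p * H₂ a b p′) ⟨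
    ∑∑ (λ a b → H₂ a b p * H₂ a b p′) * ε
      ≡⟨ cong (_* ε) (∑-pair v (λ i → H i p * H i p′)) ⟨
    (∑[ i < n ] (H i p * H i p′)) * ε
      ≡⟨ cong (_* ε) (columns-orth p p′ p≢p′) ⟩
    0ℤ * ε
      ≡⟨ *-zeroˡ ε ⟩
    0ℤ ∎
    where
    ε : ℤ
    ε = H₂ c c p * H₂ c c p′

  -- Each of the second components p, q, r occurs in exactly one factor, so sums over them can be
  -- taken factor by factor.
  T : Fin v × Fin n → Fin v × Fin n → Fin v × Fin n → ℤ
  T (a , p) (b , q) (c , r) = G c a b r * G a b c p * G b c a q

  cube : Array ℤ (v ^ 3)
  cube x y z = T (remQuot n x) (remQuot n y) (remQuot n z)

  cube-diagonal : ∀ x → cube x x x ≡ 1ℤ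
  -- On the diagonal the three factors coincide, so a single rewrite turns all of them into 1.
  cube-diagonal x rewrite G-one (proj₁ (remQuot {v} n x)) (proj₂ (remQuot {v} n x)) = refl

  T-sum : ∀ x → ∑∑ (λ b c → ∑∑ λ q r → T x (b , q) (c , r)) ≡ + n * + n
  T-sum (a , p) = begin
    ∑∑ (λ b c → ∑∑ λ q r → T (a , p) (b , q) (c , r)) ≡⟨ ∑∑-cong inner ⟩
    -- `K b c` contains the sum of `G c a b r` over r, which vanishes unless a = c and b = c. This
    -- leaves first b = a, then c = a.
    ∑∑ K                  ≡⟨ ∑-support (sum ∘ K) a (λ b b≢a → ∑-zero λ c →
                              K-zero b c λ { (refl , b≡c) → b≢a b≡c }) ⟩
    ∑[ c < v ] K a c      ≡⟨ ∑-support (K a) a (λ c c≢a →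
                              K-zero a c λ (a≡c , _) → c≢a (sym a≡c)) ⟩
    K a a                 ≡⟨ cong₂ (λ s t → s * (t * t)) (G-one a p) (∑-G-one a) ⟩
    1ℤ * (+ n * + n)      ≡⟨ *-identityˡ _ ⟩
    + n * + n             ∎
    where
    K : Fin v → Fin v → ℤ
    K b c = G a b c p * ((∑[ q < n ] G b c a q) * (∑[ r < n ] G c a b r))

    rearrange : ∀ s t u → s * t * u ≡ t * (u * s)
    rearrange = solve-∀

    inner : ∀ b c → ∑∑ (λ q r → T (a , p) (b , q) (c , r)) ≡ K b c
    inner b c = begin
      ∑∑ (λ q r → G c a b r * G a b c p * G b c a q)
        ≡⟨ ∑∑-cong (λ q r → rearrange (G c a b r) (G a b c p) (G b c a q)) ⟩
      ∑∑ (λ q r → G a b c p * (G b c a q * G c a b r))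
        ≡⟨ *-distribˡ-∑∑ (G a b c p) (λ q r → G b c a q * G c a b r) ⟨
      G a b c p * ∑∑ (λ q r → G b c a q * G c a b r)
        ≡⟨ cong (G a b c p *_) (∑∑-product (G b c a) (G c a b)) ⟩
      K b c ∎

    K-zero : ∀ b c → ¬ (a ≡ c × b ≡ c) → K b c ≡ 0ℤ
    K-zero b c h = begin
      K b c                                      ≡⟨ cong (λ t → G a b c p * ((∑[ q < n ] G b c a q) * t)) (∑-G-zero c a b h) ⟩
      G a b c p * ((∑[ q < n ] G b c a q) * 0ℤ)  ≡⟨ cong (G a b c p *_) (*-zeroʳ (∑[ q < n ] G b c a q)) ⟩
      G a b c p * 0ℤ                             ≡⟨ *-zeroʳ (G a b c p) ⟩
      0ℤ                                         ∎

  T-orth : ∀ x x′ → x ≢ x′ →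
           ∑∑ (λ b c → ∑∑ λ q r → T x (b , q) (c , r) * T x′ (b , q) (c , r)) ≡ 0ℤ
  T-orth (a , p) (a′ , p′) x≢x′ with a ≟ a′
  -- With b, c, q fixed, only the first factor of each entry depends on r; `κ` collects the others.
  ... | no a≢a′ = ∑-zero λ b → ∑-zero λ c → ∑-zero λ q →
    let κ  = (G a b c p * G b c a q) * (G a′ b c p′ * G b c a′ q)
        GG = λ r → G c a b r * G c a′ b r
    in begin
    ∑[ r < n ] (T (a , p) (b , q) (c , r) * T (a′ , p′) (b , q) (c , r))
      ≡⟨ sum-cong-≗ (λ r → rearrange (G c a b r) (G a b c p) (G b c a q)
                                     (G c a′ b r) (G a′ b c p′) (G b c a′ q)) ⟩
    ∑[ r < n ] (κ * GG r)  ≡⟨ *-distribˡ-sum κ GG ⟨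
    κ * sum GG             ≡⟨ cong (κ *_) (G-rows-orth c a a′ b a≢a′) ⟩
    κ * 0ℤ                 ≡⟨ *-zeroʳ κ ⟩
    0ℤ                     ∎
    where
    rearrange : ∀ s t u s′ t′ u′ → (s * t * u) * (s′ * t′ * u′) ≡ ((t * u) * (t′ * u′)) * (s * s′)
    rearrange = solve-∀
  -- The first and third factors do not involve p or p′, so they square to 1. What remains is the
  -- scalar product of two distinct columns of `G a`, repeated for each of the N choices of (q , r).
  ... | yes refl = begin
    ∑∑ (λ b c → ∑∑ λ q r → T (a , p) (b , q) (c , r) * T (a , p′) (b , q) (c , r))
      ≡⟨ ∑∑-cong (λ b c → ∑∑-cong λ q r → cancel b c q r) ⟩
    ∑∑ (λ b c → ∑∑ {n} {n} λ q r → GG b c * 1ℤ)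
      ≡⟨ ∑∑-cong (λ b c → *-distribˡ-∑∑ {n} {n} (GG b c) (λ q r → 1ℤ)) ⟨
    ∑∑ (λ b c → GG b c * N)
      ≡⟨ *-distribʳ-∑∑ N GG ⟨
    ∑∑ GG * N
      ≡⟨ cong (_* N) (G-columns-orth a p p′ λ { refl → x≢x′ refl }) ⟩
    0ℤ * N
      ≡⟨ *-zeroˡ N ⟩
    0ℤ ∎
    where
    GG : Fin v → Fin v → ℤ
    GG b c = G a b c p * G a b c p′

    N : ℤ
    N = ∑∑ {n} {n} λ q r → 1ℤ

    rearrange : ∀ s t u t′ → (s * t * u) * (s * t′ * u) ≡ (t * t′) * ((s * s) * (u * u))
    rearrange = solve-∀

    cancel : ∀ b c q r → T (a , p) (b , q) (c , r) * T (a , p′) (b , q) (c , r) ≡ GG b c * 1ℤ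
    cancel b c q r = trans (rearrange (G c a b r) (G a b c p) (G b c a q) (G a b c p′))
      (cong (GG b c *_) (cong₂ _*_ (sign-square (G-sign c a b r)) (sign-square (G-sign b c a q))))

  cube-isSignCube : IsSignCube (+ n * + n) cube
  cube-isSignCube = record
    { entries   = λ x y z → sign-* (sign-* (G-sign _ _ _ _) (G-sign _ _ _ _)) (G-sign _ _ _ _)
    -- Shifting the three indices permutes the factors of `T` cyclically.
    ; cyclic    = λ x y z → rotate (G (x₁ z) (x₁ x) (x₁ y) (x₂ z)) _ _
    ; layer-sum = λ x → trans (∑∑-remQuot v n (T (remQuot n x))) (T-sum (remQuot n x))
    ; orth      = λ x x′ x≢x′ → trans
        (∑∑-remQuot v n λ y z → T (remQuot n x) y z * T (remQuot n x′) y z)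
        (T-orth (remQuot n x) (remQuot n x′) (x≢x′ ∘ remQuot-injective {v} n))
    }
    where
    x₁ : Fin (v ^ 3) → Fin v
    x₁ = proj₁ ∘ remQuot n
    x₂ : Fin (v ^ 3) → Fin n
    x₂ = proj₂ ∘ remQuot {v} n

    rotate : ∀ s t u → s * t * u ≡ t * u * s
    rotate = solve-∀

-- Powers of v and assembly of the two cubes.

point : ∀ v .{{_ : NonZero v}} → Fin (v ^ 3)
point (ℕ.suc u) = combine {ℕ.suc u} 0F (pair {ℕ.suc u} 0F 0F)

pos-^-+ : ∀ v a b → + (v ^ a) * + (v ^ b) ≡ + (v ^ (a ℕ.+ b))
pos-^-+ v a b = trans (sym (pos-* (v ^ a) (v ^ b))) (cong +_ (sym (^-distribˡ-+-* v a b)))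

theorem4p14 : (v : ℕ) .{{_ : NonZero v}} (H : Matrix ℤ (v ^ 2)) → IsHadamard H →
    Σ (𝒞³₃ (v ^ 6)
    ((+ (v ^ 8) * (+ (v ^ 4) - + 1)) / 2)
    ((+ (v ^ 8) * (+ (v ^ 4) - + 2)) / 4)) λ C →
    Σ (𝒞³₃ (v ^ 3)
    ((+ (v ^ 4) * (+ (v ^ 2) - + 1)) / 2)
    ((+ (v ^ 4) * (+ (v ^ 2) - + 2)) / 4)) λ B →
    proj₁ B IsSubcubeOf proj₁ C
theorem4p14 v H isHadamard =
  -- The layer sum v² · v² is rewritten as v⁴, and below its square as v⁸.
  let isX = subst (λ s → IsSignCube s cube) (pos-^-+ v 2 2) cube-isSignCube
      -- The diagonal of `cube` is constantly 1, so any index serves; one exists because v is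
      -- nonzero.
      o = point v
      Y , isY , f , f-mono , X≡Y =
        kronecker-square {s = + (v ^ 4)} (^-distribˡ-+-* v 3 3) cube isX o (cube-diagonal o)
      isY′ = subst (λ s → IsSignCube s Y) (pos-^-+ v 4 4) isY
  in
  (bits Y , isCube 8 4 6 refl isY′) ,
  (bits cube , isCube 4 2 3 refl isX) ,
  f , f , f , (λ {x} → f-mono {x}) , (λ {x} → f-mono {x}) , (λ {x} → f-mono {x}) ,
  λ x y z → cong bit (X≡Y x y z)
  where
  open HadamardCube {v} H isHadamard

  ones-identity : ∀ x y → x + x * (y - + 1) ≡ x * y
  ones-identity = solve-∀

  product-identity : ∀ x y → (x + x) + x * (y - + 2) ≡ x * y
  product-identity = solve-∀

  -- For order v^c and layer sum s = v^a, a layer has v^(2c) = s · t positions with t = v^b.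
  -- Subtracting s or 2s then gives the factored numerators s(t - 1) and s(t - 2).
  isCube : ∀ a b c → a ℕ.+ b ≡ c ℕ.+ c → {X : Array ℤ (v ^ c)} → IsSignCube (+ (v ^ a)) X →
           IsCube ((+ (v ^ a) * (+ (v ^ b) - + 1)) / 2) ((+ (v ^ a) * (+ (v ^ b) - + 2)) / 4) (bits X)
  isCube a b c a+b≡c+c isX = bits-isCube s (s * (t - + 1)) (s * (t - + 2)) isX
    (trans (ones-identity s t) area)
    (trans (product-identity s t) area)
    where
    s t : ℤ
    s = + (v ^ a)
    t = + (v ^ b)
    area : s * t ≡ + (v ^ c) * + (v ^ c)
    area = trans (pos-^-+ v a b) (trans (cong (λ k → + (v ^ k)) a+b≡c+c) (sym (pos-^-+ v c c)))
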